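{- Let $\mu$ be an infinite cardinal and $F$ a uniform filter on $\mu$. If $\kappa$ is a strongly inaccessible cardinal such that every $\kappa$-Aronszajn tree admits an $F$-ascent path, then $\mathrm{Pr}_1(\kappa,\kappa,2,(2,\mu^+))$ fails.
   Context: A filter $F$ on $\mu$ is uniform if every member of $F$ has size $\mu$. For a tree $(T,<_T)$ of height $\kappa$ with levels $T_\alpha$, an $F$-ascent path is a sequence $\langle f_\alpha\mid\alpha<\kappa\rangle$ with $f_\alpha:\mu\to T_\alpha$ such that for all $\alpha<\beta<\kappa$, $\{i<\mu\mid f_\alpha(i)<_T f_\beta(i)\}\in F$. For sets of ordinals, $\alpha<b$ means $\alpha<\beta$ for all $\beta\in b$. $\mathrm{Pr}_1(\kappa,\kappa,\theta,(2,\chi))$ asserts the existence of $c:[\kappa]^2\to\theta$ such that for every $A\in[\kappa]^\kappa$, every $\sigma<\chi$, every pairwise disjoint family $\mathcal B\subseteq[\kappa]^\sigma$ of size $\kappa$, and every $\tau<\theta$, there are $\alpha\in A$ and $b\in\mathcal B$ with $\alpha<b$ and $c[\{\alpha\}\times b]=\{\tau\}$. -}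

module Defs where

open import Data.Fin.Base as Fin using (Fin)
import Data.Fin.Induction as Fin
import Data.Fin.Properties as Fin
open import Data.Nat.Base using (ℕ)
open import Data.Product.Base using (Σ; ∃; ∃-syntax; _×_; proj₁)
open import Data.Sum.Base using (_⊎_)
open import Function.Base using (_on_)
open import Function.Bundles using (Injection; Bijection)
import Function.Relation.Binary.Setoid.Equality as FunctionSetoid
open import Induction.WellFounded using (WellFounded)
open import Level using (Level; 0ℓ; suc; _⊔_)
open import Relation.Binary.Bundles using (Setoid)
import Relation.Binary.Construct.On as On
open import Relation.Binary.Core using (Rel)
open import Relation.Binary.Definitions using (Tri)
open import Relation.Binary.Morphism.Structures using (IsOrderIsomorphism)
open import Relation.Binary.PropositionalEquality.Core using (_≡_)
open import Relation.Binary.PropositionalEquality.Properties using (setoid)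
open import Relation.Binary.Structures using (IsStrictPartialOrder; IsStrictTotalOrder)
open import Relation.Nullary.Negation.Core using (¬_)
open import Relation.Unary using (Pred; _∈_; _∉_; _⊆_; _≐_; _∩_; _⊥_; ｛_｝)
open import Relation.Unary.Polymorphic using (U; ∅)
open import Relation.Unary.Relation.Binary.Equality using (≐-setoid)

private
  variable
    a b ℓ ℓ′ ℓ₁ ℓ₂ ℓ₃ ℓ₄ p : Level

------------------------------------------------------------------------
-- Cardinality

infix 4 _≼_ _≺_ _≃_

_≼_ : Setoid ℓ₁ ℓ₂ → Setoid ℓ₃ ℓ₄ → Set _
X ≼ Y = Injection X Y

_≺_ : Setoid ℓ₁ ℓ₂ → Setoid ℓ₃ ℓ₄ → Set _
X ≺ Y = X ≼ Y × ¬ (Y ≼ X)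

_≃_ : Setoid ℓ₁ ℓ₂ → Setoid ℓ₃ ℓ₄ → Set _
X ≃ Y = Bijection X Y

-- A predicate may have several proofs at the same point, so the set it
-- carves out is ∃ P with proofs ignored, not ∃ P with _≡_.
subsetoid : (S : Setoid ℓ₁ ℓ₂) → Pred (Setoid.Carrier S) p → Setoid (ℓ₁ ⊔ p) ℓ₂
subsetoid S P = On.setoid {B = ∃ P} S proj₁

⟪_⟫ : {A : Set a} → Pred A p → Setoid (a ⊔ p) a
⟪_⟫ {A = A} P = subsetoid (setoid A) P

-- The cardinal 2 ^ X, as the set of functions from X to a two-element set.
2^_ : Setoid ℓ₁ ℓ₂ → Setoid _ _
2^ X = FunctionSetoid.setoid X (setoid (Fin 2))

------------------------------------------------------------------------
-- Ordinals and cardinals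

-- An ordinal is given by a well-ordered type.  Its elements play the
-- role of the smaller ordinals, x standing for the order type of ↓ x.
record Ordinal ℓ : Set (suc ℓ) where
  infix 4 _<_ _≤_
  field
    Carrier            : Set ℓ
    _<_                : Rel Carrier ℓ
    isStrictTotalOrder : IsStrictTotalOrder _≡_ _<_
    wellFounded        : WellFounded _<_

  _≤_ : Rel Carrier ℓ
  x ≤ y = x < y ⊎ x ≡ y

  ↓ : Carrier → Pred Carrier ℓ
  ↓ x y = y < x

  ∣_∣ : Setoid ℓ ℓ
  ∣_∣ = setoid Carrier

open Ordinal using (Carrier; ∣_∣)

fin : ℕ → Ordinal 0ℓ
fin n = record
  { Carrier            = Fin n
  ; _<_                = Fin._<_
  ; isStrictTotalOrder = Fin.<-isStrictTotalOrder
  ; wellFounded        = Fin.<-wellFounded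
  }

module _ (κ : Ordinal ℓ) where
  open Ordinal κ using (_<_; _≤_; ↓)

  IsCardinal : Set ℓ
  IsCardinal = ∀ x → ¬ (⟪ ↓ x ⟫ ≃ ∣ κ ∣)

  Infinite : Set ℓ
  Infinite = setoid ℕ ≼ ∣ κ ∣

  Uncountable : Set ℓ
  Uncountable = setoid ℕ ≺ ∣ κ ∣

  Cofinal : Pred (Pred (Carrier κ) ℓ) ℓ
  Cofinal A = ∀ x → ∃[ y ] y ∈ A × x ≤ y

  -- cf(κ) = κ
  IsRegular : Set (suc ℓ)
  IsRegular = ∀ A → Cofinal A → ¬ (⟪ A ⟫ ≺ ∣ κ ∣)

  IsStrongLimit : Set ℓ
  IsStrongLimit = ∀ x → 2^ ⟪ ↓ x ⟫ ≺ ∣ κ ∣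

  record IsStronglyInaccessible : Set (suc ℓ) where
    field
      isCardinal    : IsCardinal
      uncountable   : Uncountable
      isRegular     : IsRegular
      isStrongLimit : IsStrongLimit

-- χ = μ⁺.  Minimality is stated among ordinals, hence also among cardinals.
record IsSuccessorCardinal (μ : Ordinal ℓ) (χ : Ordinal ℓ′) : Set (ℓ ⊔ ℓ′) where
  field
    isCardinal : IsCardinal χ
    larger     : ∣ μ ∣ ≺ ∣ χ ∣
    least      : ∀ x → ¬ (∣ μ ∣ ≺ ⟪ Ordinal.↓ χ x ⟫)

------------------------------------------------------------------------
-- Filters

record Filter (M : Set ℓ) p : Set (suc (ℓ ⊔ p)) where
  field
    Member       : Pred (Pred M ℓ) p
    universe     : U ∈ Member
    proper       : ∅ ∉ Member
    upward       : ∀ {X Y} → X ⊆ Y → X ∈ Member → Y ∈ Member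
    intersection : ∀ {X Y} → X ∈ Member → Y ∈ Member → X ∩ Y ∈ Member

IsUniform : (μ : Ordinal ℓ) → Filter (Carrier μ) p → Set _
IsUniform μ F = ∀ X → X ∈ Filter.Member F → ⟪ X ⟫ ≃ ∣ μ ∣

------------------------------------------------------------------------
-- Trees

record Tree ℓ : Set (suc ℓ) where
  infix 4 _<_
  field
    Node                 : Set ℓ
    _<_                  : Rel Node ℓ
    isStrictPartialOrder : IsStrictPartialOrder _≡_ _<_

  ↓ : Node → Pred Node ℓ
  ↓ t s = s < t

  -- Together these say that each ↓ t is well-ordered: well-foundedness of
  -- _<_ is the same as well-foundedness of its restriction to every ↓ t.
  field
    ↓-compare   : ∀ {t x y} → x ∈ ↓ t → y ∈ ↓ t → Tri (x < y) (x ≡ y) (y < x)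
    wellFounded : WellFounded _<_

module _ (κ : Ordinal ℓ) (T : Tree ℓ) where
  private
    module κ = Ordinal κ
    module T = Tree T

  -- t ∈ Lev α iff the order type of the predecessors of t is α.
  Lev : Carrier κ → Pred T.Node ℓ
  Lev α t = Σ (∃ (T.↓ t) → ∃ (κ.↓ α))
    (IsOrderIsomorphism (_≡_ on proj₁) (_≡_ on proj₁) (T._<_ on proj₁) (κ._<_ on proj₁))

  record HasHeight : Set ℓ where
    field
      nonempty : ∀ α → ∃[ t ] t ∈ Lev α
      bounded  : ∀ t → ∃[ α ] t ∈ Lev α

  -- A chain meeting every level is automatically a maximal chain.
  record IsCofinalBranch (B : Pred T.Node ℓ) : Set ℓ where
    field
      chain     : ∀ {s t} → s ∈ B → t ∈ B → s T.< t ⊎ s ≡ t ⊎ t T.< s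
      unbounded : ∀ α → ∃[ t ] t ∈ B × t ∈ Lev α

  record IsAronszajn : Set (suc ℓ) where
    field
      hasHeight   : HasHeight
      smallLevels : ∀ α → ⟪ Lev α ⟫ ≺ ∣ κ ∣
      noBranch    : ∀ B → ¬ IsCofinalBranch B

  record AscentPath {M : Set ℓ} (F : Filter M p) : Set (ℓ ⊔ p) where
    field
      path    : Carrier κ → M → T.Node
      inLevel : ∀ α i → path α i ∈ Lev α
      ascends : ∀ {α β} → α κ.< β → (λ i → path α i T.< path β i) ∈ Filter.Member F

------------------------------------------------------------------------
-- Pr₁(κ,κ,θ,(2,χ))

-- [ S ]^ X is the collection of subsets of S of size |X|.
[_]^_ : (S : Set a) → Setoid ℓ₁ ℓ₂ → Pred (Pred S a) _
([ S ]^ X) A = ⟪ A ⟫ ≃ X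

PairwiseDisjoint : {S : Set a} → Pred (Pred (Pred S a) b) _
PairwiseDisjoint {S = S} ℬ =
  ∀ (b b′ : Pred S _) → b ∈ ℬ → b′ ∈ ℬ → ¬ (b ≐ b′) → b ⊥ b′

module _ (κ : Ordinal ℓ) (θ : Ordinal ℓ₁) (χ : Ordinal ℓ₂) where
  open Ordinal κ using (_<_)

  private
    K : Set ℓ
    K = Carrier κ

  -- c[{α} × b]
  image : (K → K → Carrier θ) → K → Pred K ℓ → Pred (Carrier θ) _
  image c α b t = ∃[ β ] β ∈ b × c α β ≡ t

  -- An unordered pair is identified with the (α , β) such that α < β; the
  -- values of c at other arguments play no role.  The size of the family ℬ
  -- is counted up to extensional equality of its members.
  Pr₁[κ,κ,θ,⟨2,χ⟩] : Set _
  Pr₁[κ,κ,θ,⟨2,χ⟩] =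
    ∃[ c ] ∀ (A : Pred K ℓ) → A ∈ [ K ]^ ∣ κ ∣ →
           ∀ (σ : Carrier χ) (ℬ : Pred (Pred K ℓ) ℓ) →
           ℬ ⊆ [ K ]^ ⟪ Ordinal.↓ χ σ ⟫ →
           PairwiseDisjoint ℬ →
           subsetoid (≐-setoid K ℓ) ℬ ≃ ∣ κ ∣ →
           ∀ (τ : Carrier θ) →
           ∃[ α ] ∃[ b ] α ∈ A × b ∈ ℬ ×
             (∀ {β} → β ∈ b → α < β) × image c α b ≐ ｛ τ ｝

{-
Let c witness Pr₁(κ,κ,2,(2,μ⁺)), and consider the tree of those restrictions of
columns c(·,β) to an ordinal α < κ that are shared by cofinally many columns.  Its
levels are nonempty and smaller than κ because κ is a regular strong limit.  If it
has no cofinal branch, it is Aronszajn and the hypothesis gives an F-ascent path; a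
cofinal branch gives one directly, by repeating its nodes μ times.

Choose columns e(γ,i) extending the i-th entry of the path at level γ + 1,
injectively in i, and thin out γ so that the blocks b_γ = {e(γ,i) | i < μ} lie one
above the other.  For each α some colour τ is such that the set of i for which the
path at level α + 1 takes the colour 1 − τ at α is not in F; fix a τ that occurs for
κ many α.  If α < b_γ and c[{α} × b_γ] = {1 − τ} for such an α, then coherence of
the path puts that set into F after all, a contradiction.

This needs μ < κ.  Otherwise μ⁺ has an element of size κ, and already c cannot exist:
for some τ, κ many rows take the value τ cofinally often, and one can choose κ many
disjoint sets of size κ each of which meets the τ-part of each of these rows.
-}
module Submission where

open import Axiom.DoubleNegationElimination using (em⇒dne)
open import Axiom.ExcludedMiddle using (ExcludedMiddle)
open import Data.Empty using (⊥-elim)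
open import Data.Fin.Base using (Fin; zero; suc; opposite)
open import Data.Product.Base using (Σ; ∃; ∃-syntax; _×_; _,_; proj₁; proj₂)
open import Data.Product.Relation.Binary.Lex.Strict using (×-Lex; ×-wellFounded)
open import Data.Sum.Base using (_⊎_; inj₁; inj₂)
open import Data.Unit.Polymorphic.Base using (⊤)
open import Function.Base using (_∘_; _on_; case_of_)
open import Function.Bundles using (Injection; Bijection)
import Function.Construct.Composition as Composition
open import Induction.WellFounded using (WellFounded; module All; module FixPoint; module Subrelation)
open import Level using (Level; 0ℓ; Lift; lift; lower; _⊔_)
open import Relation.Binary.Bundles using (Setoid)
import Relation.Binary.Construct.On as On
import Relation.Binary.Construct.StrictToNonStrict as StrictToNonStrict
open import Relation.Binary.Core using (Rel)
open import Relation.Binary.Definitions using (Tri; tri<; tri≈; tri>)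
open import Relation.Binary.Morphism.Structures using (IsOrderIsomorphism)
open import Relation.Binary.PropositionalEquality.Core using (_≡_; _≢_; refl; sym; trans; cong; subst; resp₂)
open import Relation.Binary.PropositionalEquality.Properties using (setoid; isEquivalence)
open import Relation.Binary.Structures using (IsStrictTotalOrder)
open import Relation.Nullary.Decidable.Core using (yes; no; recompute; True; toWitness; fromWitness)
open import Relation.Nullary.Negation.Core using (¬_)
open import Relation.Unary using (Pred; _∈_; _∉_; _⊆_; _≐_)
open import Relation.Unary.Relation.Binary.Equality using (≐-setoid)
open import Relation.Unary.Polymorphic using (U)
open import Defs

private
  variable
    a b ℓ ℓ₁ ℓ₂ ℓ₃ ℓ₄ p q r w : Level

opposite-≢ : ∀ (τ : Fin 2) → opposite τ ≢ τ
opposite-≢ zero       ()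
opposite-≢ (suc zero) ()

module Classical (em : ∀ {a} → ExcludedMiddle a) where

  -- Classical reasoning and injections obtained from relations.

  ¬¬-elim : {P : Set p} → ¬ ¬ P → P
  ¬¬-elim = em⇒dne em

  ¬∀⇒∃¬ : {A : Set a} {P : Pred A p} → ¬ (∀ x → P x) → ∃[ x ] ¬ P x
  ¬∀⇒∃¬ ¬∀ = ¬¬-elim λ ¬∃ → ¬∀ λ x → ¬¬-elim λ ¬Px → ¬∃ (x , ¬Px)

  opaque
    relation⇒≼ : {A : Set a} (P : Pred A p) (S : Setoid ℓ₁ ℓ₂) (let open Setoid S)
                 (R : A → Carrier → Set r) →
                 (∀ {x} → x ∈ P → ∃ (R x)) →
                 (∀ {x y s t} → R x s → R y t → s ≈ t → x ≡ y) →
                 ⟪ P ⟫ ≼ S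
    relation⇒≼ P S R total inj = record
      { to        = λ (x , Px) → proj₁ (choice Px)
      ; cong      = λ { {x , _} refl → Setoid.refl S }
      ; injective = λ { {x , Px} {y , Py} → inj (proj₂ (choice Px)) (proj₂ (choice Py)) }
      }
      where
      -- Recomputing the witness makes it depend on x alone, not on the proof of P x.
      choice : ∀ {x} → .(x ∈ P) → ∃ (R x)
      choice Px = recompute em (total Px)

  -- The Cantor-Schröder-Bernstein theorem.

  module _ {X : Setoid ℓ₁ ℓ₂} {Y : Setoid ℓ₃ ℓ₄} (X≼Y : X ≼ Y) (Y≼X : Y ≼ X) where
    private
      module X = Setoid X
      module Y = Setoid Y
      module F = Injection X≼Y
      module G = Injection Y≼X

      -- The elements reached from outside the range of `G` by iterating `G` after `F`. The
      -- bijection follows `F` on these and inverts `G` on all others.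
      data Orphan : X.Carrier → Set (ℓ₁ ⊔ ℓ₂ ⊔ ℓ₃ ⊔ ℓ₄) where
        root : ∀ {x} → (∀ y → ¬ (G.to y X.≈ x)) → Orphan x
        step : ∀ {x x′} → Orphan x → G.to (F.to x) X.≈ x′ → Orphan x′

      Orphan-resp : ∀ {x x′} → x X.≈ x′ → Orphan x → Orphan x′
      Orphan-resp x≈x′ (root ∉G)  = root λ y Gy≈x′ → ∉G y (X.trans Gy≈x′ (X.sym x≈x′))
      Orphan-resp x≈x′ (step o e) = step o (X.trans e x≈x′)

      -- As a relation, it can be shown single-valued and injective up to `≈` without comparing the
      -- decisions that `em` makes at two equivalent arguments.
      Match : X.Carrier → Y.Carrier → Set _
      Match x y = (Orphan x × F.to x Y.≈ y) ⊎ (¬ Orphan x × G.to y X.≈ x)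

      match : ∀ x → ∃ (Match x)
      match x with em {P = Orphan x}
      ... | yes o = F.to x , inj₁ (o , Y.refl)
      ... | no ¬o with em {P = ∃[ y ] G.to y X.≈ x}
      ...   | yes (y , e) = y , inj₂ (¬o , e)
      ...   | no ∉G       = ⊥-elim (¬o (root λ y e → ∉G (y , e)))

      Match-functional : ∀ {x x′ y y′} → Match x y → Match x′ y′ → x X.≈ x′ → y Y.≈ y′
      Match-functional (inj₁ (_ , e)) (inj₁ (_ , e′)) x≈x′ =
        Y.trans (Y.sym e) (Y.trans (F.cong x≈x′) e′)
      Match-functional (inj₁ (o , _)) (inj₂ (¬o , _)) x≈x′ = ⊥-elim (¬o (Orphan-resp x≈x′ o))
      Match-functional (inj₂ (¬o , _)) (inj₁ (o , _)) x≈x′ =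
        ⊥-elim (¬o (Orphan-resp (X.sym x≈x′) o))
      Match-functional (inj₂ (_ , e)) (inj₂ (_ , e′)) x≈x′ =
        G.injective (X.trans e (X.trans x≈x′ (X.sym e′)))

      Match-injective : ∀ {x x′ y y′} → Match x y → Match x′ y′ → y Y.≈ y′ → x X.≈ x′
      Match-injective (inj₁ (_ , e)) (inj₁ (_ , e′)) y≈y′ =
        F.injective (Y.trans e (Y.trans y≈y′ (Y.sym e′)))
      Match-injective (inj₁ (o , e)) (inj₂ (¬o , e′)) y≈y′ =
        ⊥-elim (¬o (step o (X.trans (G.cong (Y.trans e y≈y′)) e′)))
      Match-injective (inj₂ (¬o , e)) (inj₁ (o , e′)) y≈y′ =
        ⊥-elim (¬o (step o (X.trans (G.cong (Y.trans e′ (Y.sym y≈y′))) e)))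
      Match-injective (inj₂ (_ , e)) (inj₂ (_ , e′)) y≈y′ =
        X.trans (X.sym e) (X.trans (G.cong y≈y′) e′)

      Match-surjective : ∀ y → ∃[ x ] Match x y
      Match-surjective y with em {P = Orphan (G.to y)}
      ... | yes (root ∉G)          = ⊥-elim (∉G y X.refl)
      ... | yes (step {x = x} o e) = x , inj₁ (o , G.injective e)
      ... | no ¬o                  = G.to y , inj₂ (¬o , X.refl)

    opaque
      schröder-bernstein : X ≃ Y
      schröder-bernstein = record
        { to        = proj₁ ∘ match
        ; cong      = Match-functional (proj₂ (match _)) (proj₂ (match _))
        ; bijective = Match-injective (proj₂ (match _)) (proj₂ (match _))
                    , λ y → let (x , m) = Match-surjective y in
                            x , Match-functional (proj₂ (match _)) m
        }

  -- Least elements of well-orders.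

  module OrdinalProperties (W : Ordinal ℓ) where
    open Ordinal W public
    open IsStrictTotalOrder isStrictTotalOrder public
      using (compare; irrefl; asym) renaming (trans to <-trans)

    ⟪⟫≼ : {P : Pred Carrier p} → ⟪ P ⟫ ≼ ∣_∣
    ⟪⟫≼ = record { to = proj₁ ; cong = λ e → e ; injective = λ e → e }

    Least : Pred Carrier p → Pred Carrier _
    Least P x = P x × (∀ {y} → y < x → ¬ P y)

    least : {P : Pred Carrier p} → ∃ P → ∃ (Least P)
    least {P = P} (x , Px) = All.wfRec wellFounded _ (λ x → P x → ∃ (Least P)) go x Px
      where
      go : ∀ x → (∀ {y} → y < x → P y → ∃ (Least P)) → P x → ∃ (Least P)
      go x ih Px with em {P = ∃[ y ] y < x × P y}
      ... | yes (y , y<x , Py) = ih y<x Py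
      ... | no minimal         = x , Px , λ y<x Py → minimal (_ , y<x , Py)

    Least-unique : ∀ {P : Pred Carrier p} {Q : Pred Carrier q} {x y} →
                   P ≐ Q → Least P x → Least Q y → x ≡ y
    Least-unique {x = x} {y} (P⊆Q , Q⊆P) (Px , x-min) (Qy , y-min) with compare x y
    ... | tri< x<y _ _ = ⊥-elim (y-min x<y (P⊆Q Px))
    ... | tri≈ _ x≡y _ = x≡y
    ... | tri> _ _ y<x = ⊥-elim (x-min y<x (Q⊆P Qy))

    module _ (x₀ : Carrier) where
      leastOr : Pred Carrier p → Carrier
      leastOr P with em {P = ∃ P}
      ... | yes Px = proj₁ (least Px)
      ... | no _   = x₀

      leastOr-∈ : {P : Pred Carrier p} → ∃ P → leastOr P ∈ P
      leastOr-∈ {P = P} Px with em {P = ∃ P}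
      ... | yes Px′ = proj₁ (proj₂ (least Px′))
      ... | no ¬Px  = ⊥-elim (¬Px Px)

      leastOr-cong : {P : Pred Carrier p} {Q : Pred Carrier q} → P ≐ Q → leastOr P ≡ leastOr Q
      leastOr-cong {P = P} {Q} P≐Q@(P⊆Q , Q⊆P) with em {P = ∃ P} | em {P = ∃ Q}
      ... | yes Px       | yes Qx       = Least-unique P≐Q (proj₂ (least Px)) (proj₂ (least Qx))
      ... | yes (x , Px) | no ¬Q        = ⊥-elim (¬Q (x , P⊆Q Px))
      ... | no ¬P        | yes (x , Qx) = ⊥-elim (¬P (x , Q⊆P Qx))
      ... | no _         | no _         = refl

  -- Recursive choice along well-founded relations.

  module _ {W : Set w} {_≪_ : Rel W r} (≪-wf : WellFounded _≪_)
           (Y : Ordinal ℓ) (y₀ : Ordinal.Carrier Y) where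
    private
      module Y = OrdinalProperties Y

      Candidate : (W → Pred Y.Carrier p) → Rel Y.Carrier q →
                  ∀ x → (∀ {v} → v ≪ x → Y.Carrier) → Pred Y.Carrier (w ⊔ r ⊔ p ⊔ q)
      Candidate P Q x rec y = P x y × (∀ {v} (v≪x : v ≪ x) → Q (rec v≪x) y)

    -- Taking the least candidate at each step makes the recursion extensional,
    -- so that it can be unfolded without function extensionality.
    opaque
      recursion : (P : W → Pred Y.Carrier p) (Q : Rel Y.Carrier q) →
                  Σ (W → Y.Carrier) λ f →
                    ∀ x → ∃ (Candidate P Q x (λ {v} _ → f v)) → Candidate P Q x (λ {v} _ → f v) (f x)
      recursion P Q = f , λ x ∃y →
        subst (Candidate P Q x (λ {v} _ → f v)) (sym f-unfold) (Y.leastOr-∈ y₀ ∃y)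
        where
        F : ∀ x → (∀ {v} → v ≪ x → Y.Carrier) → Y.Carrier
        F x rec = Y.leastOr y₀ (Candidate P Q x rec)

        F-ext : ∀ x {rec rec′ : ∀ {v} → v ≪ x → Y.Carrier} →
                (∀ {v} (v≪x : v ≪ x) → rec v≪x ≡ rec′ v≪x) → F x rec ≡ F x rec′
        F-ext x eq = Y.leastOr-cong y₀
          ( (λ (Py , Qy) → Py , λ v≪x → subst (λ z → Q z _) (eq v≪x) (Qy v≪x))
          , (λ (Py , Qy) → Py , λ v≪x → subst (λ z → Q z _) (sym (eq v≪x)) (Qy v≪x)))

        f : W → Y.Carrier
        f = All.wfRec ≪-wf _ (λ _ → Y.Carrier) F

        f-unfold : ∀ {x} → f x ≡ F x (λ {v} _ → f v)
        f-unfold = FixPoint.unfold-wfRec ≪-wf (λ _ → Y.Carrier) F F-ext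

    opaque
      -- If the earlier values exhausted `P x`, sending each element of `P x` to an argument where
      -- it was taken would embed `P x` into the segment below `x`. Otherwise a fresh value is left
      -- to choose.
      transversal : (P : W → Pred Y.Carrier p) →
                    Σ (W → Y.Carrier) λ f →
                      ∀ x → ¬ (⟪ P x ⟫ ≼ ⟪ _≪ x ⟫) → P x (f x) × (∀ {v} → v ≪ x → f v ≢ f x)
      transversal P = f , λ x P⋠ → f-good x (¬¬-elim (P⋠ ∘ exhausted⇒≼ x))
        where
        f : W → Y.Carrier
        f = proj₁ (recursion P _≢_)

        f-good : ∀ x → ∃ (Candidate P _≢_ x (λ {v} _ → f v)) → Candidate P _≢_ x (λ {v} _ → f v) (f x)
        f-good = proj₂ (recursion P _≢_)

        exhausted⇒≼ : ∀ x → ¬ ∃ (Candidate P _≢_ x (λ {v} _ → f v)) → ⟪ P x ⟫ ≼ ⟪ _≪ x ⟫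
        exhausted⇒≼ x none = relation⇒≼ (P x) ⟪ _≪ x ⟫ (λ y (v , _) → f v ≡ y)
          (λ Py → ¬¬-elim λ fresh → none (_ , Py , λ v≪x fv≡y → fresh ((_ , v≪x) , fv≡y)))
          (λ { refl refl refl → refl })

  -- Initial segments of prescribed size.

  module _ (χ : Ordinal ℓ₁) (Y : Ordinal ℓ) (y₀ : Ordinal.Carrier Y) where
    private
      module χ = OrdinalProperties χ
      module Y = OrdinalProperties Y

    opaque
      -- Take the least `σ` whose segment has room for `Y`. Segments below it have none, so choosing
      -- fresh values of `Y` embeds `↓ σ` into `Y`. If there were no such `σ`, the same choice would
      -- embed all of `χ`.
      initialSegment-of-size : ¬ (χ.∣_∣ ≼ Y.∣_∣) → ∃[ σ ] ⟪ χ.↓ σ ⟫ ≃ Y.∣_∣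
      initialSegment-of-size χ⋠Y =
        let (σ , (Y≼↓σ , smaller)) = χ.least (¬¬-elim (λ none → χ⋠Y (χ≼Y none)))
        in σ , schröder-bernstein
                 (record { to = f ∘ proj₁ ; cong = cong f
                         ; injective = λ { {x , x<σ} {y , y<σ} → f-injective (smaller x<σ) (smaller y<σ) } })
                 Y≼↓σ
        where
        Small : Pred χ.Carrier (ℓ₁ ⊔ ℓ)
        Small x = ¬ (Y.∣_∣ ≼ ⟪ χ.↓ x ⟫)

        everything : Pred Y.Carrier 0ℓ
        everything = U

        f : χ.Carrier → Y.Carrier
        f = proj₁ (transversal χ.wellFounded Y y₀ (λ _ → everything))

        Y≼U : Y.∣_∣ ≼ ⟪ everything ⟫
        Y≼U = record { to = λ y → y , _ ; cong = λ e → e ; injective = λ e → e }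

        f-fresh : ∀ {x y} → Small x → y χ.< x → f y ≢ f x
        f-fresh small = proj₂ (proj₂ (transversal χ.wellFounded Y y₀ (λ _ → everything)) _
          (λ U≼↓x → small (Composition.injection Y≼U U≼↓x)))

        f-injective : ∀ {x y} → Small x → Small y → f x ≡ f y → x ≡ y
        f-injective {x} {y} Sx Sy fx≡fy with χ.compare x y
        ... | tri< x<y _ _ = ⊥-elim (f-fresh Sy x<y fx≡fy)
        ... | tri≈ _ x≡y _ = x≡y
        ... | tri> _ _ y<x = ⊥-elim (f-fresh Sx y<x (sym fx≡fy))

        χ≼Y : ¬ (∃[ σ ] Y.∣_∣ ≼ ⟪ χ.↓ σ ⟫) → χ.∣_∣ ≼ Y.∣_∣
        χ≼Y none = record { to = f ; cong = cong f
                          ; injective = f-injective (λ s → none (_ , s)) (λ s → none (_ , s)) }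

  -- Regularity and pigeonhole arguments.

  module Inaccessible (κ : Ordinal ℓ) (inaccessible : IsStronglyInaccessible κ) where
    open OrdinalProperties κ public renaming (Carrier to K)
    open IsStronglyInaccessible inaccessible

    cofinal⇒large : {A : Pred K ℓ} → Cofinal κ A → ∣_∣ ≼ ⟪ A ⟫
    cofinal⇒large {A} cofinal = ¬¬-elim λ small → isRegular A cofinal (⟪⟫≼ , small)

    ≮⇒≤ : ∀ {x y} → ¬ (x < y) → y ≤ x
    ≮⇒≤ {x} {y} x≮y with compare x y
    ... | tri< x<y _ _ = ⊥-elim (x≮y x<y)
    ... | tri≈ _ x≡y _ = inj₂ (sym x≡y)
    ... | tri> _ _ y<x = inj₁ y<x

    private
      module NonStrict = StrictToNonStrict _≡_ _<_

    <-≤-trans : ∀ {x y z} → x < y → y ≤ z → x < z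
    <-≤-trans = NonStrict.<-≤-trans <-trans (proj₁ (resp₂ _<_))

    ≤-<-trans : ∀ {x y z} → x ≤ y → y < z → x < z
    ≤-<-trans = NonStrict.≤-<-trans sym <-trans (proj₂ (resp₂ _<_))

    ≤-trans : ∀ {x y z} → x ≤ y → y ≤ z → x ≤ z
    ≤-trans = NonStrict.trans isEquivalence (resp₂ _<_) <-trans

    not-cofinal⇒bounded : {A : Pred K ℓ} → ¬ Cofinal κ A → ∃[ x ] ∀ {y} → y ∈ A → y < x
    not-cofinal⇒bounded ¬cofinal =
      let (x , bound) = ¬∀⇒∃¬ ¬cofinal
      in x , λ {y} y∈A → ¬¬-elim λ y≮x → bound (y , y∈A , ≮⇒≤ y≮x)

    opaque
      -- The image of `g` embeds into `S`, so if it were cofinal, regularity would embed `κ` into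
      -- `S`.
      bounded : (S : Setoid ℓ ℓ) (let open Setoid S) → ¬ (∣_∣ ≼ S) →
                (g : Carrier → K) → (∀ {s t} → s ≈ t → g s ≡ g t) → ∃[ x ] ∀ s → g s < x
      bounded S κ⋠S g g-cong =
        let (x , bound) = not-cofinal⇒bounded {A = Image} (λ cofinal → κ⋠S
              (Composition.injection (cofinal⇒large cofinal)
                (relation⇒≼ Image S (λ x s → g s ≡ x) (λ ∈Im → ∈Im) (λ { refl refl → g-cong }))))
        in x , λ s → bound (s , refl)
        where
        Image : Pred K ℓ
        Image x = ∃[ s ] g s ≡ x

    κ⋠⊤ : ¬ (∣_∣ ≼ setoid (⊤ {ℓ}))
    κ⋠⊤ κ≼⊤ = case Injection.injective (proj₁ uncountable) {0} {1} (Injection.injective κ≼⊤ refl) of λ ()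

    opaque
      -- Only some strictly larger element is produced, not necessarily the immediate successor.
      successor : ∀ x → ∃[ y ] x < y
      successor x = let (y , x<y) = bounded (setoid ⊤) κ⋠⊤ (λ _ → x) (λ _ → refl) in y , x<y _

    x₀ : K
    x₀ = Injection.to (proj₁ uncountable) 0

    κ⋠↓ : ∀ x → ¬ (∣_∣ ≼ ⟪ ↓ x ⟫)
    κ⋠↓ x κ≼↓x = isCardinal x (schröder-bernstein ⟪⟫≼ κ≼↓x)

    opaque
      upper-bound : ∀ x y → ∃[ z ] x ≤ z × y ≤ z
      upper-bound x y with compare x y
      ... | tri< x<y _ _ = y , inj₁ x<y , inj₂ refl
      ... | tri≈ _ x≡y _ = y , inj₂ x≡y , inj₂ refl
      ... | tri> _ _ y<x = x , inj₂ refl , inj₁ y<x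

    cofinal-tail : {A : Pred K ℓ} → Cofinal κ A → ∀ x → Cofinal κ (λ y → y ∈ A × x ≤ y)
    cofinal-tail cofinal x y =
      let (z , x≤z , y≤z) = upper-bound x y
          (a , a∈A , z≤a) = cofinal z
      in a , (a∈A , ≤-trans x≤z z≤a) , ≤-trans y≤z z≤a

    opaque
      cofinal-split : (A : Fin 2 → Pred K ℓ) → (∀ x → ∃[ τ ] x ∈ A τ) → ∃[ τ ] Cofinal κ (A τ)
      cofinal-split A cover with em {P = Cofinal κ (A zero)}
      ... | yes cofinal = zero , cofinal
      ... | no ¬cofinal = suc zero , in-A₁
        where
        bound : ∃[ x ] ∀ {y} → y ∈ A zero → y < x
        bound = not-cofinal⇒bounded ¬cofinal

        in-A₁ : Cofinal κ (A (suc zero))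
        in-A₁ x with upper-bound x (proj₁ bound)
        ... | (y , x≤y , b≤y) with cover y
        ...   | zero     , y∈A₀ = ⊥-elim (irrefl refl (<-≤-trans (proj₂ bound y∈A₀) b≤y))
        ...   | suc zero , y∈A₁ = y , y∈A₁ , x≤y

    opaque
      -- If all fibres were bounded, their bounds would have a common strict bound `x`. But `x` lies
      -- in the fibre over `f x`, hence below the bound of that fibre. Taking least bounds makes the
      -- choice respect `≈`.
      pigeonhole : (S : Setoid ℓ ℓ) (let open Setoid S) → ¬ (∣_∣ ≼ S) → (f : K → Carrier) →
                   ∃[ s ] Cofinal κ (λ x → f x ≈ s)
      pigeonhole S κ⋠S f = ¬¬-elim λ none →
        let least-bound s = least (not-cofinal⇒bounded {A = λ x → f x ≈ s} λ cofinal → none (s , cofinal))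
            (x , large)   = bounded S κ⋠S (proj₁ ∘ least-bound) (λ {s} {t} s≈t →
              Least-unique (Bound-resp s≈t , Bound-resp (Setoid.sym S s≈t))
                (proj₂ (least-bound s)) (proj₂ (least-bound t)))
        in asym (large (f x)) (proj₁ (proj₂ (least-bound (f x))) (Setoid.refl S))
        where
        open Setoid S using (_≈_) renaming (Carrier to C)

        Bound : C → Pred K ℓ
        Bound s x = ∀ {y} → f y ≈ s → y < x

        Bound-resp : ∀ {s t} → s ≈ t → Bound s ⊆ Bound t
        Bound-resp s≈t bound fy≈t = bound (Setoid.trans S fy≈t (Setoid.sym S s≈t))

    opaque
      -- At stage `y` there are fewer than `κ` earlier values, so regularity bounds their images
      -- under `g`.
      sparse-sequence : (g : K → K) → Σ (K → K) λ s → ∀ {x y} → x < y → g (s x) < s y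
      sparse-sequence g = s , λ {x} {y} x<y →
        proj₂ (proj₂ (recursion wellFounded κ x₀ (λ _ → U) (λ y z → g y < z)) y (free y)) x<y
        where
        s : K → K
        s = proj₁ (recursion wellFounded κ x₀ (λ _ → U {ℓ = ℓ}) (λ y z → g y < z))

        free : ∀ y → ∃[ z ] z ∈ U {ℓ = ℓ} × (∀ {x} → x < y → g (s x) < z)
        free y = let (z , bound) = bounded ⟪ ↓ y ⟫ (κ⋠↓ y) (g ∘ s ∘ proj₁) (cong (g ∘ s))
                 in z , _ , λ x<y → bound (_ , x<y)

    -- Injective choice from cofinal sets indexed by pairs.

    private
      max : K × K → K
      max (x , y) = proj₁ (upper-bound x y)

      -- Gödel's ordering of pairs, whose initial segments lie inside squares.
      _≪_ : Rel (K × K) ℓ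
      _≪_ = ×-Lex _≡_ _<_ (×-Lex _≡_ _<_ _<_) on λ v → max v , v

      ≪-wellFounded : WellFounded _≪_
      ≪-wellFounded = On.wellFounded (λ v → max v , v)
        (×-wellFounded wellFounded (×-wellFounded wellFounded wellFounded))

      ≪-connected : ∀ v w → v ≪ w ⊎ v ≡ w ⊎ w ≪ v
      ≪-connected (x , y) (x′ , y′)
        with compare (max (x , y)) (max (x′ , y′)) | compare x x′ | compare y y′
      ... | tri< m _ _ | _ | _ = inj₁ (inj₁ m)
      ... | tri> _ _ m | _ | _ = inj₂ (inj₂ (inj₁ m))
      ... | tri≈ _ e _ | tri< m _ _ | _ = inj₁ (inj₂ (e , inj₁ m))
      ... | tri≈ _ e _ | tri> _ _ m | _ = inj₂ (inj₂ (inj₂ (sym e , inj₁ m)))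
      ... | tri≈ _ e _ | tri≈ _ refl _ | tri< m _ _ = inj₁ (inj₂ (e , inj₂ (refl , m)))
      ... | tri≈ _ e _ | tri≈ _ refl _ | tri≈ _ refl _ = inj₂ (inj₁ refl)
      ... | tri≈ _ e _ | tri≈ _ refl _ | tri> _ _ m = inj₂ (inj₂ (inj₂ (sym e , inj₂ (refl , m))))

      ≪⇒max≤ : ∀ {v w} → v ≪ w → max v ≤ max w
      ≪⇒max≤ (inj₁ m)       = inj₁ m
      ≪⇒max≤ (inj₂ (e , _)) = inj₂ e

      ≪⇒≤ : ∀ {v w} → v ≪ w → proj₁ v ≤ max w × proj₂ v ≤ max w
      ≪⇒≤ {x , y} {w} v≪w =
        let (x≤m , y≤m) = proj₂ (upper-bound x y)
            m≤          = ≪⇒max≤ {x , y} {w} v≪w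
        in ≤-trans x≤m m≤ , ≤-trans y≤m m≤

      -- Pairs below `w` have both coordinates below `m`. An injection from `κ` would have a
      -- constant first coordinate on a cofinal set, where the second coordinate would then embed
      -- `κ` into `↓ m`. No cardinal multiplication is involved.
      κ⋠≪ : ∀ w → ¬ (∣_∣ ≼ ⟪ _≪ w ⟫)
      κ⋠≪ w κ≼≪w = κ⋠↓ m (Composition.injection (cofinal⇒large cofinal) (record
        { to        = second ∘ proj₁
        ; cong      = λ { refl → refl }
        ; injective = λ { {x , e} {y , e′} eq → F.injective (×-≡ (trans e (sym e′)) eq) }
        }))
        where
        module F = Injection κ≼≪w
        m,<m = successor (max w)
        m = proj₁ m,<m

        first second : K → ∃ (↓ m)
        first  x = let (v , v≪w) = F.to x in proj₁ v , ≤-<-trans (proj₁ (≪⇒≤ {v} {w} v≪w)) (proj₂ m,<m)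
        second x = let (v , v≪w) = F.to x in proj₂ v , ≤-<-trans (proj₂ (≪⇒≤ {v} {w} v≪w)) (proj₂ m,<m)

        cofinal = proj₂ (pigeonhole ⟪ ↓ m ⟫ (κ⋠↓ m) first)

        ×-≡ : ∀ {v w : K × K} → proj₁ v ≡ proj₁ w → proj₂ v ≡ proj₂ w → v ≡ w
        ×-≡ refl refl = refl

    opaque
      -- A cofinal set has size `κ`, while the segments of Gödel's ordering are smaller, so a fresh
      -- value is available for every pair.
      pairs-transversal : (P : K → K → Pred K ℓ) → (∀ x y → Cofinal κ (P x y)) →
                          Σ (K → K → K) λ h →
                            (∀ x y → h x y ∈ P x y) ×
                            (∀ {x y x′ y′} → h x y ≡ h x′ y′ → x ≡ x′ × y ≡ y′)
      pairs-transversal P cofinal =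
        (λ x y → f (x , y)) , (λ x y → proj₁ (good (x , y))) , λ {x} {y} {x′} {y′} → injective (x , y) (x′ , y′)
        where
        f : K × K → K
        f = proj₁ (transversal ≪-wellFounded κ x₀ (λ (x , y) → P x y))

        good : ∀ w → f w ∈ P (proj₁ w) (proj₂ w) × (∀ {v} → v ≪ w → f v ≢ f w)
        good w = proj₂ (transversal ≪-wellFounded κ x₀ (λ (x , y) → P x y)) w λ P≼≪w →
          κ⋠≪ w (Composition.injection (cofinal⇒large (cofinal (proj₁ w) (proj₂ w))) P≼≪w)

        injective : ∀ v w → f v ≡ f w → proj₁ v ≡ proj₁ w × proj₂ v ≡ proj₂ w
        injective v w fv≡fw with ≪-connected v w
        ... | inj₁ v≪w         = ⊥-elim (proj₂ (good w) v≪w fv≡fw)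
        ... | inj₂ (inj₁ refl) = refl , refl
        ... | inj₂ (inj₂ w≪v)  = ⊥-elim (proj₂ (good v) w≪v (sym fv≡fw))

    -- Pr₁ for injectively indexed families of blocks.

    module _ (χ : Ordinal ℓ₁) (pr : Pr₁[κ,κ,θ,⟨2,χ⟩] κ (fin 2) χ) where
      private
        c : K → K → Fin 2
        c = proj₁ pr

      -- Joint injectivity of `e` makes the blocks disjoint and of size `I`. The point `i₀` makes
      -- them inhabited, so that a block determines its index and there are `κ` many.
      Pr₁-indexed : {I : Set ℓ} → I → ∃[ σ ] ⟪ Ordinal.↓ χ σ ⟫ ≃ setoid I →
                    {e : K → I → K} → (∀ {x y i j} → e x i ≡ e y j → x ≡ y × i ≡ j) →
                    {A : Pred K ℓ} → ∣_∣ ≼ ⟪ A ⟫ →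
                    ∀ τ → ∃[ α ] ∃[ x ] α ∈ A × (∀ i → α < e x i × c α (e x i) ≡ τ)
      Pr₁-indexed {I} i₀ (σ , ↓σ≃I) {e} e-injective {A} κ≼A τ =
        let (α , b , α∈A , (x , b⊆block , block⊆b) , α<b , (image⊆τ , _)) =
              proj₂ pr A (schröder-bernstein ⟪⟫≼ κ≼A) σ ℬ block≃σ disjoint ℬ≃κ τ
        in α , x , α∈A , λ i →
             α<b (block⊆b (i , refl)) , sym (image⊆τ (e x i , block⊆b (i , refl) , refl))
        where
        module σ = Bijection ↓σ≃I

        block : K → Pred K ℓ
        block x y = ∃[ i ] e x i ≡ y

        -- Extensional equality keeps this at level `ℓ`; propositional equality of predicates lives
        -- one level higher.
        ℬ : Pred (Pred K ℓ) ℓ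
        ℬ b = ∃[ x ] b ≐ block x

        block≃σ : ℬ ⊆ [ K ]^ ⟪ Ordinal.↓ χ σ ⟫
        block≃σ {b} (x , b⊆block , block⊆b) = schröder-bernstein
          (relation⇒≼ b ⟪ Ordinal.↓ χ σ ⟫ (λ y s → e x (σ.to s) ≡ y)
            (λ y∈b → let (i , eq)  = b⊆block y∈b
                         (s , to≡) = σ.strictlySurjective i
                     in s , trans (cong (e x) to≡) eq)
            (λ { refl refl s≈t → cong (e x) (σ.cong s≈t) }))
          (record { to        = λ s → e x (σ.to s) , block⊆b (_ , refl)
                  ; cong      = cong (e x) ∘ σ.cong
                  ; injective = σ.injective ∘ proj₂ ∘ e-injective })

        meeting : ∀ {b b′ y} → (bℬ : b ∈ ℬ) (b′ℬ : b′ ∈ ℬ) → y ∈ b → y ∈ b′ → proj₁ bℬ ≡ proj₁ b′ℬ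
        meeting (x , b⊆ , _) (x′ , b′⊆ , _) y∈b y∈b′ =
          let (i , eq) = b⊆ y∈b ; (j , eq′) = b′⊆ y∈b′ in proj₁ (e-injective (trans eq (sym eq′)))

        same : ∀ {b b′} → (bℬ : b ∈ ℬ) (b′ℬ : b′ ∈ ℬ) → proj₁ bℬ ≡ proj₁ b′ℬ → b ≐ b′
        same (_ , b⊆ , ⊆b) (_ , b′⊆ , ⊆b′) refl = (λ y → ⊆b′ (b⊆ y)) , (λ y → ⊆b (b′⊆ y))

        disjoint : PairwiseDisjoint ℬ
        disjoint b b′ bℬ b′ℬ b≢b′ (y∈b , y∈b′) =
          ⊥-elim (b≢b′ (same bℬ b′ℬ (meeting bℬ b′ℬ y∈b y∈b′)))

        ℬ≃κ : subsetoid (≐-setoid K ℓ) ℬ ≃ ∣_∣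
        ℬ≃κ = record
          { to        = proj₁ ∘ proj₂
          ; cong      = λ { {_ , bℬ@(_ , _ , ⊆b)} {_ , b′ℬ} (b⊆b′ , _) →
                            let y∈b = ⊆b (i₀ , refl) in meeting bℬ b′ℬ y∈b (b⊆b′ y∈b) }
          ; bijective = (λ { {_ , bℬ} {_ , b′ℬ} → same bℬ b′ℬ })
                      , λ x → (block x , x , (λ y → y) , (λ y → y))
                            , λ { {_ , bℬ@(_ , b⊆ , ⊆b)} (b⊆block , _) →
                                  let y∈b = ⊆b (i₀ , refl)
                                  in meeting bℬ (x , (λ y → y) , (λ y → y)) y∈b (b⊆block y∈b) }
          }

      opaque
        Pr₁⇒χ≼κ : Ordinal.∣_∣ χ ≼ ∣_∣
        Pr₁⇒χ≼κ = ¬¬-elim λ χ⋠κ →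
          let (τ , cofinal)              = cofinal-split Often often
              (h , h-hits , h-injective) = pairs-transversal
                (λ _ α β → α ∈ Often τ → Lift ℓ (c α β ≡ τ)) (λ _ → hits τ)
              (α , x , α∈Often , mono)   = Pr₁-indexed x₀ (initialSegment-of-size χ κ x₀ χ⋠κ)
                h-injective (cofinal⇒large cofinal) (opposite τ)
          -- The entry of the block at index `α` was chosen to have colour `τ` in row `α`, against
          -- the constant colour of the block.
          in opposite-≢ τ (trans (sym (proj₂ (mono α))) (lower (h-hits x α α∈Often)))
          where
          Often : Fin 2 → Pred K ℓ
          Often τ α = Cofinal κ (λ β → Lift ℓ (c α β ≡ τ))

          often : ∀ α → ∃[ τ ] α ∈ Often τ
          often α = cofinal-split (λ τ β → Lift ℓ (c α β ≡ τ)) (λ β → c α β , lift refl)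

          -- For rows outside `Often τ` the condition is void and thus cofinal too, which lets
          -- `pairs-transversal` handle all rows at once.
          hits : ∀ τ α → Cofinal κ (λ β → α ∈ Often τ → Lift ℓ (c α β ≡ τ))
          hits τ α β with em {P = α ∈ Often τ}
          ... | yes often-τ = let (γ , eq , β≤γ) = often-τ β in γ , (λ _ → eq) , β≤γ
          ... | no ¬often-τ = β , (λ often-τ → ⊥-elim (¬often-τ often-τ)) , inj₂ refl

    -- The tree of restrictions of columns.

    -- A node stands for the restriction to its level of a column c(·,β) such that
    -- cofinally many columns restrict to the same function, β being least possible.
    module RestrictionTree (c : K → K → Fin 2) where

      Agree : K → K → K → Set ℓ
      Agree α β γ = ∀ {x} → x < α → c x β ≡ c x γ

      Agree-sym : ∀ {α β γ} → Agree α β γ → Agree α γ β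
      Agree-sym β≈γ x<α = sym (β≈γ x<α)

      Agree-trans : ∀ {α β γ δ} → Agree α β γ → Agree α γ δ → Agree α β δ
      Agree-trans β≈γ γ≈δ x<α = trans (β≈γ x<α) (γ≈δ x<α)

      Agree-< : ∀ {α α′ β γ} → α′ < α → Agree α β γ → Agree α′ β γ
      Agree-< α′<α β≈γ x<α′ = β≈γ (<-trans x<α′ α′<α)

      Canonical : K → K → Set ℓ
      Canonical α β = Cofinal κ (Agree α β) × (∀ {γ} → γ < β → ¬ Agree α γ β)

      -- The irrelevant field makes nodes with the same level and index equal; `recompute` recovers
      -- the proof when it is needed.
      record Node : Set ℓ where
        constructor node
        field
          level index : K
          .canonical  : Canonical level index

      open Node

      canonical! : ∀ t → Canonical (level t) (index t)
      canonical! (node _ _ canonical) = recompute em canonical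

      node-≡ : ∀ {s t} → level s ≡ level t → Agree (level s) (index s) (index t) → s ≡ t
      node-≡ {s@(node α β _)} {t@(node .α γ _)} refl β≈γ with compare β γ
      ... | tri< β<γ _ _ = ⊥-elim (proj₂ (canonical! t) β<γ β≈γ)
      ... | tri≈ _ refl _ = refl
      ... | tri> _ _ γ<β = ⊥-elim (proj₂ (canonical! s) γ<β (Agree-sym β≈γ))

      restrict : ∀ α β → Cofinal κ (Agree α β) → Σ Node λ t → level t ≡ α × Agree α (index t) β
      restrict α β fat =
        let (γ , γ≈β , γ-min) = least {P = λ γ → Agree α γ β} (β , λ _ → refl)
        in node α γ ( (λ x → let (δ , β≈δ , x≤δ) = fat x in δ , Agree-trans γ≈β β≈δ , x≤δ)
                    , λ δ<γ δ≈γ → γ-min δ<γ (Agree-trans δ≈γ γ≈β))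
         , refl , γ≈β

      infix 4 _⊏_
      record _⊏_ (s t : Node) : Set ℓ where
        constructor below
        field
          level-< : level s < level t
          agree   : Agree (level s) (index s) (index t)

      open _⊏_

      ⊏-trans : ∀ {s t u} → s ⊏ t → t ⊏ u → s ⊏ u
      ⊏-trans (below s<t s≈t) (below t<u t≈u) = below (<-trans s<t t<u) (Agree-trans s≈t (Agree-< s<t t≈u))

      ⊏-below : ∀ {s t u} → s ⊏ u → t ⊏ u → level s < level t → s ⊏ t
      ⊏-below (below _ s≈u) (below _ t≈u) s<t = below s<t (Agree-trans s≈u (Agree-sym (Agree-< s<t t≈u)))

      ⊏-≡ : ∀ {s t u} → s ⊏ u → t ⊏ u → level s ≡ level t → s ≡ t
      ⊏-≡ {node _ _ _} {node _ _ _} (below _ s≈u) (below _ t≈u) refl =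
        node-≡ refl (Agree-trans s≈u (Agree-sym t≈u))

      -- A shorter restriction is shared by at least the same columns, so it is again represented by
      -- a node.
      predecessor : ∀ t {α} → α < level t → Σ Node λ s → s ⊏ t × level s ≡ α
      predecessor t {α} α<t =
        let (s , s≡α , s≈t) = restrict α (index t) λ x →
              let (γ , t≈γ , x≤γ) = proj₁ (canonical! t) x in γ , Agree-< α<t t≈γ , x≤γ
        in s , below (subst (_< level t) (sym s≡α) α<t) (subst (λ β → Agree β (index s) (index t)) (sym s≡α) s≈t)
             , s≡α

      tree : Tree ℓ
      tree = record
        { Node                 = Node
        ; _<_                  = _⊏_
        ; isStrictPartialOrder = record
          { isEquivalence = isEquivalence
          ; irrefl        = λ { refl (below s<s _) → irrefl refl s<s }
          ; trans         = ⊏-trans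
          ; <-resp-≈      = resp₂ _⊏_
          }
        ; ↓-compare            = ↓-compare
        ; wellFounded          = Subrelation.wellFounded level-< (On.wellFounded level wellFounded)
        }
        where
        ↓-compare : ∀ {t x y} → x ⊏ t → y ⊏ t → Tri (x ⊏ y) (x ≡ y) (y ⊏ x)
        ↓-compare {t} {x} {y} x⊏t y⊏t with compare (level x) (level y)
        ... | tri< x<y x≢y y≮x = tri< (⊏-below x⊏t y⊏t x<y) (x≢y ∘ cong level) (y≮x ∘ level-<)
        ... | tri≈ x≮y x≡y y≮x = tri≈ (x≮y ∘ level-<) (⊏-≡ x⊏t y⊏t x≡y) (y≮x ∘ level-<)
        ... | tri> x≮y x≢y y<x = tri> (x≮y ∘ level-<) (x≢y ∘ cong level) (⊏-below y⊏t x⊏t y<x)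

      -- Levels and height of the tree.

      ∈Lev : ∀ t → t ∈ Lev κ tree (level t)
      -- A node has exactly one predecessor at each lower level, so taking levels is the required
      -- isomorphism.
      ∈Lev t = (λ (s , s⊏t) → level s , level-< s⊏t) , record
        { isOrderMonomorphism = record
          { isOrderHomomorphism = record { cong = λ { refl → refl } ; mono = level-< }
          ; injective           = λ { {_ , s⊏t} {_ , s′⊏t} → ⊏-≡ s⊏t s′⊏t }
          ; cancel              = λ { {_ , s⊏t} {_ , s′⊏t} → ⊏-below s⊏t s′⊏t }
          }
        ; surjective = λ (α , α<t) →
            let (s , s⊏t , s≡α) = predecessor t α<t in (s , s⊏t) , λ { refl → s≡α }
        }

      -- Rigidity of well-orders: an isomorphism of the predecessors of `t` with a segment shorter
      -- or longer than `level t` would be regressive somewhere, or its inverse would be.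
      Lev⇒level≡ : ∀ t {α} → t ∈ Lev κ tree α → level t ≡ α
      Lev⇒level≡ t {α} (φ , φ-iso) with compare (level t) α
      ... | tri≈ _ t≡α _ = t≡α
      ... | tri> _ _ α<t =
        let (s , s⊏t , s≡α) = predecessor t α<t
        in ⊥-elim (φ-not-regressive (level s) (s , s⊏t) refl
                    (subst (proj₁ (φ (s , s⊏t)) <_) (sym s≡α) (proj₂ (φ (s , s⊏t)))))
        where
        open IsOrderIsomorphism φ-iso

        -- If `φ` maps `s` below its level, it does the same to the predecessor of `s` at level
        -- `φ s`, giving an infinite descent.
        φ-not-regressive : ∀ x (s : ∃ (_⊏ t)) → level (proj₁ s) ≡ x → ¬ (proj₁ (φ s) < x)
        φ-not-regressive = All.wfRec wellFounded _ _ λ { _ ih (s , s⊏t) refl φs<s →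
          let (r , r⊏s , r≡φs) = predecessor s φs<s
              r⊏t              = ⊏-trans r⊏s s⊏t
          in ih φs<s (r , r⊏t) r≡φs (mono {r , r⊏t} {s , s⊏t} r⊏s) }
      ... | tri< t<α _ _ =
        let ((s , s⊏t) , eq) = surjective (level t , t<α)
        in ⊥-elim (ψ-not-regressive (level t) (s , s⊏t) (eq refl) (level-< s⊏t))
        where
        open IsOrderIsomorphism φ-iso

        -- The same descent for the inverse of `φ`, along the values of `φ` instead of the levels.
        ψ-not-regressive : ∀ x (s : ∃ (_⊏ t)) → proj₁ (φ s) ≡ x → ¬ (level (proj₁ s) < x)
        ψ-not-regressive = All.wfRec wellFounded _ _ λ { _ ih (s , s⊏t) refl s<φs →
          let ((r , r⊏t) , eq) = surjective (level s , <-trans s<φs (proj₂ (φ (s , s⊏t))))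
              r⊏s              = cancel {r , r⊏t} {s , s⊏t} (subst (_< proj₁ (φ (s , s⊏t))) (sym (eq refl)) s<φs)
          in ih s<φs (r , r⊏t) (eq refl) (level-< r⊏s) }

      column : ∀ α → K → Setoid.Carrier (2^ ⟪ ↓ α ⟫)
      column α β = record { to = λ (x , _) → c x β ; cong = λ { refl → refl } }

      κ⋠2^ : ∀ α → ¬ (∣_∣ ≼ 2^ ⟪ ↓ α ⟫)
      κ⋠2^ α = proj₂ (isStrongLimit α)

      Lev≼2^ : ∀ α → ⟪ Lev κ tree α ⟫ ≼ 2^ ⟪ ↓ α ⟫
      Lev≼2^ α = record
        { to        = λ (t , _) → column α (index t)
        ; cong      = λ { refl _ → refl }
        ; injective = λ { {s , s∈} {t , t∈} eq → node-≡ (trans (Lev⇒level≡ s s∈) (sym (Lev⇒level≡ t t∈)))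
                          (λ x<s → eq (_ , subst (_ <_) (Lev⇒level≡ s s∈) x<s)) }
        }

      hasHeight : HasHeight κ tree
      hasHeight = record { nonempty = nonempty ; bounded = λ t → level t , ∈Lev t }
        where
        nonempty : ∀ α → ∃[ t ] t ∈ Lev κ tree α
        nonempty α =
          let (s , fat)     = pigeonhole (2^ ⟪ ↓ α ⟫) (κ⋠2^ α) (column α)
              -- Any column with the restriction `s` will do; `x₀` is an arbitrary argument.
              (β , β≈s , _) = fat x₀
              (t , t≡α , _) = restrict α β λ x → let (γ , γ≈s , x≤γ) = fat x in
                                γ , (λ x<α → trans (β≈s (_ , x<α)) (sym (γ≈s (_ , x<α)))) , x≤γ
          in t , subst (λ β → t ∈ Lev κ tree β) t≡α (∈Lev t)

      smallLevels : ∀ α → ⟪ Lev κ tree α ⟫ ≺ ∣_∣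
      smallLevels α = Composition.injection (Lev≼2^ α) (proj₁ (isStrongLimit α))
                    , λ κ≼Lev → κ⋠2^ α (Composition.injection κ≼Lev (Lev≼2^ α))

      -- Ascent paths through the tree.

      module _ {M : Set ℓ} (F : Filter M p) where
        open Filter F

        branch⇒ascentPath : ∀ {B} → IsCofinalBranch κ tree B → AscentPath κ tree F
        branch⇒ascentPath B-branch = record
          { path    = λ α _ → proj₁ (unbounded α)
          ; inLevel = λ α _ → proj₂ (proj₂ (unbounded α))
          ; ascends = λ α<β → upward (λ _ → ascending α<β) universe
          }
          where
          open IsCofinalBranch B-branch

          ascending : ∀ {α β} → α < β → proj₁ (unbounded α) ⊏ proj₁ (unbounded β)
          ascending {α} {β} α<β
            with (s , s∈B , s∈) ← unbounded α | (t , t∈B , t∈) ← unbounded β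
            with refl ← Lev⇒level≡ s s∈ | refl ← Lev⇒level≡ t t∈ | chain s∈B t∈B
          ... | inj₁ s⊏t               = s⊏t
          ... | inj₂ (inj₁ refl)       = ⊥-elim (irrefl refl α<β)
          ... | inj₂ (inj₂ (below t<s _)) = ⊥-elim (asym α<β t<s)

        opaque
          ascentPath : (∀ (T : Tree ℓ) → IsAronszajn κ T → AscentPath κ T F) → AscentPath κ tree F
          ascentPath Aronszajn⇒path with em {P = ∃ (IsCofinalBranch κ tree)}
          ... | yes (_ , branch) = branch⇒ascentPath branch
          ... | no none          = Aronszajn⇒path tree record
            { hasHeight = hasHeight ; smallLevels = smallLevels ; noBranch = λ B branch → none (B , branch) }

        opaque
          -- Restates the path without the tree, through the columns that represent its nodes.
          coherent-columns : AscentPath κ tree F → Σ (K → M → K) λ g →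
                             (∀ α i → Cofinal κ (Agree α (g α i))) ×
                             (∀ {α β} → α < β → (λ i → Agree α (g α i) (g β i)) ∈ Member)
          coherent-columns ap = (λ α i → index (path α i))
            , (λ α i → subst (λ β → Cofinal κ (Agree β (index (path α i)))) (level-path α i)
                         (proj₁ (canonical! (path α i))))
            , (λ {α} {β} α<β → upward {Y = λ i → Agree α (index (path α i)) (index (path β i))}
                (λ {i} (below _ agree) →
                  subst (λ γ → Agree γ (index (path α i)) (index (path β i))) (level-path α i) agree)
                (ascends α<β))
            where
            open AscentPath ap

            level-path : ∀ α i → level (path α i) ≡ α
            level-path α i = Lev⇒level≡ (path α i) (inLevel α i)

    -- The contradiction when `κ` does not embed into `μ`.

    module _ (μ : Ordinal ℓ) (i₀ : Ordinal.Carrier μ) (κ⋠μ : ¬ (∣_∣ ≼ Ordinal.∣_∣ μ))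
             (F : Filter (Ordinal.Carrier μ) p)
             (Aronszajn⇒path : ∀ (T : Tree ℓ) → IsAronszajn κ T → AscentPath κ T F)
             (χ : Ordinal ℓ₁) (χ⋠μ : ¬ (Ordinal.∣_∣ χ ≼ Ordinal.∣_∣ μ)) where
      private
        module μ = OrdinalProperties μ
        open Filter F

      ¬Pr₁ : ¬ Pr₁[κ,κ,θ,⟨2,χ⟩] κ (fin 2) χ
      ¬Pr₁ pr =
        let (τ , cofinal)                     = cofinal-split Good good
            (_ , y , (x , sx≡α , x∈) , mono) =
              Pr₁-indexed χ pr i₀ (initialSegment-of-size χ μ i₀ χ⋠μ) {e} e-injective {A τ}
                (Composition.injection (cofinal⇒large cofinal) (Good≼A τ)) (opposite τ)
        in clash τ x y x∈ (subst (λ α → ∀ i → α < e y i × c α (e y i) ≡ opposite τ) (sym sx≡α) mono)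
        where
        c : K → K → Fin 2
        c = proj₁ pr

        open RestrictionTree c

        columns = coherent-columns F (ascentPath F Aronszajn⇒path)

        g : K → μ.Carrier → K
        g = proj₁ columns

        fat : ∀ α i → Cofinal κ (Agree α (g α i))
        fat = proj₁ (proj₂ columns)

        -- Coherence holds up to the lower of the two levels, which exceeds `x` whichever it is.
        agreement : ∀ α β {x} → x < α → x < β → (λ i → Lift ℓ (c x (g α i) ≡ c x (g β i))) ∈ Member
        agreement α β x<α x<β with compare α β
        ... | tri< α<β _ _  = upward (λ agree → lift (agree x<α)) (proj₂ (proj₂ columns) α<β)
        ... | tri≈ _ refl _ = upward (λ _ → lift refl) universe
        ... | tri> _ _ β<α  = upward (λ agree → lift (sym (agree x<β))) (proj₂ (proj₂ columns) β<α)

        up : K → K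
        up α = proj₁ (successor α)

        <up : ∀ α → α < up α
        <up α = proj₂ (successor α)

        -- The candidates for the `i`-th entry of the block at `α`. The second condition places the
        -- block above `α`.
        Fibre : K → μ.Carrier → Pred K ℓ
        Fibre α i y = Agree (up α) (g (up α) i) y × up α ≤ y

        Fibre⋠ : ∀ α i → ¬ (⟪ Fibre α i ⟫ ≼ ⟪ μ.↓ i ⟫)
        Fibre⋠ α i Fibre≼↓i = κ⋠μ (Composition.injection
          (cofinal⇒large (cofinal-tail (fat (up α) i) (up α))) (Composition.injection Fibre≼↓i μ.⟪⟫≼))

        e′ : K → μ.Carrier → K
        e′ α = proj₁ (transversal μ.wellFounded κ x₀ (Fibre α))

        e-spec : ∀ α i → e′ α i ∈ Fibre α i
        e-spec α i = proj₁ (proj₂ (transversal μ.wellFounded κ x₀ (Fibre α)) i (Fibre⋠ α i))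

        e-fresh : ∀ α {i j} → j μ.< i → e′ α j ≢ e′ α i
        e-fresh α {i} = proj₂ (proj₂ (transversal μ.wellFounded κ x₀ (Fibre α)) i (Fibre⋠ α i))

        e′-injective : ∀ α {i j} → e′ α i ≡ e′ α j → i ≡ j
        e′-injective α {i} {j} eq with μ.compare i j
        ... | tri< i<j _ _ = ⊥-elim (e-fresh α i<j eq)
        ... | tri≈ _ i≡j _ = i≡j
        ... | tri> _ _ j<i = ⊥-elim (e-fresh α j<i (sym eq))

        e-bounded : ∀ α → ∃[ β ] ∀ i → e′ α i < β
        e-bounded α = bounded μ.∣_∣ κ⋠μ (e′ α) (cong (e′ α))

        s : K → K
        s = proj₁ (sparse-sequence (proj₁ ∘ e-bounded))

        e : K → μ.Carrier → K
        e x = e′ (s x)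

        e<s : ∀ {x y} → x < y → ∀ i → e x i < s y
        e<s {x} x<y i = <-trans (proj₂ (e-bounded (s x)) i) (proj₂ (sparse-sequence (proj₁ ∘ e-bounded)) x<y)

        s<e : ∀ x i → s x < e x i
        s<e x i = <-≤-trans (<up (s x)) (proj₂ (e-spec (s x) i))

        e-injective : ∀ {x y i j} → e x i ≡ e y j → x ≡ y × i ≡ j
        e-injective {x} {y} {i} {j} eq with compare x y
        ... | tri< x<y _ _  = ⊥-elim (irrefl eq (<-trans (e<s x<y i) (s<e y j)))
        ... | tri≈ _ refl _ = refl , e′-injective (s x) eq
        ... | tri> _ _ y<x  = ⊥-elim (irrefl (sym eq) (<-trans (e<s y<x j) (s<e x i)))

        -- If `y < x`, the whole block of `y` would lie below `s x`. The case `x ≡ y` is not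
        -- excluded and does no harm.
        before : ∀ x y → s x < e y i₀ → s x < up (s y)
        before x y sx<ey with compare x y
        ... | tri< x<y _ _  = <-trans (<-trans (s<e x i₀) (e<s x<y i₀)) (<up (s y))
        ... | tri≈ _ refl _ = <up (s x)
        ... | tri> _ _ y<x  = ⊥-elim (asym sx<ey (e<s y<x i₀))

        Coloured : Fin 2 → K → Pred μ.Carrier ℓ
        Coloured τ α i = Lift ℓ (c α (g (up α) i) ≡ τ)

        -- Membership in F lives at level p; True brings it down to one that Pr₁ accepts.
        Good : Fin 2 → Pred K ℓ
        Good τ x = Lift ℓ (True (em {P = Coloured (opposite τ) (s x) ∉ Member}))

        -- The index sets of the two colours are disjoint, so a proper filter cannot contain both.
        good : ∀ x → ∃[ τ ] x ∈ Good τ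
        good x with em {P = Coloured zero (s x) ∈ Member}
        ... | no 0∉F  = suc zero , lift (fromWitness 0∉F)
        ... | yes 0∈F = zero , lift (fromWitness λ 1∈F → proper (upward
              (λ { (lift ≡0 , lift ≡1) → case trans (sym ≡0) ≡1 of λ () }) (intersection 0∈F 1∈F)))

        A : Fin 2 → Pred K ℓ
        A τ α = ∃[ x ] s x ≡ α × x ∈ Good τ

        Good≼A : ∀ τ → ⟪ Good τ ⟫ ≼ ⟪ A τ ⟫
        Good≼A τ = record
          { to        = λ (x , x∈) → s x , x , refl , x∈
          ; cong      = cong s
          ; injective = λ eq → proj₁ (e-injective (cong (λ α → e′ α i₀) eq))
          }

        -- The block extends the nodes at level `up (s y)`, so all of these have colour `opposite τ`
        -- at `s x`. By `agreement` so do the nodes at level `up (s x)` for a set of indices in `F`,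
        -- contrary to the choice of `x`.
        clash : ∀ τ x y → x ∈ Good τ → ¬ (∀ i → s x < e y i × c (s x) (e y i) ≡ opposite τ)
        clash τ x y (lift x∈) mono = toWitness x∈ (upward
          (λ { {i} (lift eq) →
            lift (trans eq (trans (proj₁ (e-spec (s y) i) sx<up) (proj₂ (mono i)))) })
          (agreement (up (s x)) (up (s y)) (<up (s x)) sx<up))
          where
          sx<up : s x < up (s y)
          sx<up = before x y (proj₁ (mono i₀))

theorem4p17 : (∀ {a} → ExcludedMiddle a) →
    ∀ {ℓ p} (μ : Ordinal ℓ) → IsCardinal μ → Infinite μ →
    (F : Filter (Ordinal.Carrier μ) p) → IsUniform μ F →
    (κ : Ordinal ℓ) → IsStronglyInaccessible κ →
    (∀ (T : Tree ℓ) → IsAronszajn κ T → AscentPath κ T F) →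
    (μ⁺ : Ordinal ℓ) → IsSuccessorCardinal μ μ⁺ →
    ¬ Pr₁[κ,κ,θ,⟨2,χ⟩] κ (fin 2) μ⁺
theorem4p17 em μ _ infinite F _ κ inaccessible Aronszajn⇒path μ⁺ successor pr =
  ¬Pr₁ μ (Injection.to infinite 0) κ⋠μ F Aronszajn⇒path μ⁺ μ⁺⋠μ pr
  where
  open Classical em
  open Inaccessible κ inaccessible using (¬Pr₁; Pr₁⇒χ≼κ)

  μ⁺⋠μ : ¬ (Ordinal.∣_∣ μ⁺ ≼ Ordinal.∣_∣ μ)
  μ⁺⋠μ = proj₂ (IsSuccessorCardinal.larger successor)

  -- Pr₁ embeds `μ⁺` into `κ`, so an embedding of `κ` into `μ` would carry `μ⁺` into `μ`.
  κ⋠μ : ¬ (Ordinal.∣_∣ κ ≼ Ordinal.∣_∣ μ)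
  κ⋠μ κ≼μ = μ⁺⋠μ (Composition.injection (Pr₁⇒χ≼κ μ⁺ pr) κ≼μ)
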